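{- Let $F$ and $G$ be connected finite simple graphs such that $G$ is a $k$-fold cover of $F$. Then $\gamma_c(G) \leq k(\gamma_c(F) + 2) - 2$. Moreover, this bound is tight: for every positive integer $k$ there exist connected graphs $F$ and $G$ with $G$ a $k$-fold cover of $F$ such that $\gamma_c(G) = k(\gamma_c(F)+2) - 2$.
   Context: All graphs are finite, simple and undirected. A graph $G$ is a cover of a graph $F$ if there is an onto map $\pi: V(G)\to V(F)$ such that for every vertex $v$ of $G$, $\pi$ maps the neighbours of $v$ in $G$ bijectively onto the neighbours of $\pi(v)$ in $F$; the cover is $k$-fold if every fibre $\pi^{ -1}(u)$ has exactly $k$ vertices. A connected dominating set of a graph is a set $S$ of vertices such that every vertex not in $S$ is adjacent to some vertex of $S$ and the subgraph induced by $S$ is connected; $\gamma_c(\cdot)$ denotes the connected domination number, the minimum size of a connected dominating set (defined for connected graphs). -}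

module Defs where

open import Data.Fin.Base using (Fin; zero; suc)
open import Data.Fin.Properties using (_≟_; all?; any?)
open import Data.Fin.Subset using (Subset; inside; outside; _∈_; _∉_; ⊤; ∣_∣)
open import Data.Fin.Subset.Properties using (_∈?_; ∈⊤; anySubset?)
open import Data.List.Base using (List; []; _∷_; map)
open import Data.List.Membership.Propositional using () renaming (_∈_ to _∈ₗ_)
open import Data.List.Membership.Propositional.Properties using (∈-map⁺)
import Data.List.Relation.Unary.All as All
open import Data.List.Relation.Unary.Any using (here; there)
open import Data.Nat.Base using (ℕ; _≤_; _<_)
open import Data.Nat.Induction using (<-rec)
open import Data.Nat.Properties using (≮⇒≥; anyUpTo?) renaming (_≟_ to _≟ℕ_)
open import Data.Product.Base using (∃; _×_; _,_; proj₁; proj₂)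
open import Data.Sum.Base using (_⊎_; inj₁; inj₂)
open import Data.Vec.Base using ([]; _∷_; tabulate; here; there)
open import Data.Vec.Properties.WithK using ([]=-irrelevant)
open import Function.Definitions using (Surjective)
open import Relation.Binary.Construct.Closure.ReflexiveTransitive using (Star; ε; _◅_; _◅◅_; gmap)
open import Relation.Binary.Definitions using (Decidable; DecidableEquality; Symmetric)
open import Relation.Binary.PropositionalEquality using (_≡_; refl; cong; subst)
open import Relation.Nullary.Decidable using (Dec; yes; no; does; map′; _×-dec_; _⊎-dec_; _→-dec_; ¬?)
open import Relation.Nullary.Negation using (¬_; contradiction)

-- Simple undirected graphs; finite graphs are those with V = Fin n.
-- Decidability of adjacency is automatic classically.
record Graph (V : Set) : Set₁ where
  field
    Adj     : V → V → Set
    adj?    : Decidable Adj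
    adj-sym : Symmetric Adj
    irrefl  : ∀ {v} → ¬ Adj v v

open Graph public

-- The graph without vertices is not connected.
Connected : {V : Set} → Graph V → Set
Connected {V} G = V × (∀ u v → Star (Adj G) u v)

induced : ∀ {n} → Graph (Fin n) → (S : Subset n) → Graph (∃ λ v → v ∈ S)
induced G S = record
  { Adj     = λ u v → Adj G (proj₁ u) (proj₁ v)
  ; adj?    = λ u v → adj? G (proj₁ u) (proj₁ v)
  ; adj-sym = adj-sym G
  ; irrefl  = irrefl G
  }

fibre : ∀ {m n} → (Fin n → Fin m) → Fin m → Subset n
fibre π u = tabulate (λ v → does (π v ≟ u))

-- The three nbr- fields say that, for every v, π maps the
-- neighbours of v bijectively onto the neighbours of π v.
record KFoldCover (k : ℕ) {m n} (G : Graph (Fin n)) (F : Graph (Fin m)) : Set where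
  field
    π              : Fin n → Fin m
    onto           : Surjective _≡_ _≡_ π
    nbr-maps       : ∀ v {w} → Adj G v w → Adj F (π v) (π w)
    nbr-injective  : ∀ v {w w′} → Adj G v w → Adj G v w′ → π w ≡ π w′ → w ≡ w′
    nbr-surjective : ∀ v {x} → Adj F (π v) x → ∃ λ w → Adj G v w × π w ≡ x
    fibre-size     : ∀ u → ∣ fibre π u ∣ ≡ k

Dominating : ∀ {n} → Graph (Fin n) → Subset n → Set
Dominating G S = ∀ v → v ∉ S → ∃ λ u → u ∈ S × Adj G v u

ConnectedDominating : ∀ {n} → Graph (Fin n) → Subset n → Set
ConnectedDominating G S = Dominating G S × Connected (induced G S)

IsConnectedDominationNumber : ∀ {n} → Graph (Fin n) → ℕ → Set
IsConnectedDominationNumber G c =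
  (∃ λ S → ConnectedDominating G S × ∣ S ∣ ≡ c) ×
  (∀ S → ConnectedDominating G S → c ≤ ∣ S ∣)

-- Warshall's algorithm: Via R xs u v holds if v can be reached from u by an
-- R-walk of which all intermediate vertices are in xs.
module _ {V : Set} (R : V → V → Set) where

  Via : List V → V → V → Set
  Via []       u v = u ≡ v ⊎ R u v
  Via (x ∷ xs) u v = Via xs u v ⊎ (Via xs u x × Via xs x v)

  via? : DecidableEquality V → Decidable R → ∀ xs → Decidable (Via xs)
  via? _≟V_ R? []       u v = (u ≟V v) ⊎-dec R? u v
  via? _≟V_ R? (x ∷ xs) u v =
    via? _≟V_ R? xs u v ⊎-dec (via? _≟V_ R? xs u x ×-dec via? _≟V_ R? xs x v)

  via⇒star : ∀ xs {u v} → Via xs u v → Star R u v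
  via⇒star []       (inj₁ refl)    = ε
  via⇒star []       (inj₂ r)       = r ◅ ε
  via⇒star (x ∷ xs) (inj₁ p)       = via⇒star xs p
  via⇒star (x ∷ xs) (inj₂ (p , q)) = via⇒star xs p ◅◅ via⇒star xs q

  via-base : ∀ xs {u v} → u ≡ v ⊎ R u v → Via xs u v
  via-base []       b = b
  via-base (x ∷ xs) b = inj₁ (via-base xs b)

  via-trans : ∀ xs {u x v} → x ∈ₗ xs → Via xs u x → Via xs x v → Via xs u v
  via-trans (y ∷ ys) (here refl) p q = inj₂ (to p , from q)
    where
    to : ∀ {u} → Via (y ∷ ys) u y → Via ys u y
    to (inj₁ p)       = p
    to (inj₂ (p , _)) = p
    from : ∀ {v} → Via (y ∷ ys) y v → Via ys y v
    from (inj₁ q)       = q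
    from (inj₂ (_ , q)) = q
  via-trans (y ∷ ys) (there i) (inj₁ p)       (inj₁ q)       = inj₁ (via-trans ys i p q)
  via-trans (y ∷ ys) (there i) (inj₁ p)       (inj₂ (q , r)) = inj₂ (via-trans ys i p q , r)
  via-trans (y ∷ ys) (there i) (inj₂ (o , p)) (inj₁ q)       = inj₂ (o , via-trans ys i p q)
  via-trans (y ∷ ys) (there i) (inj₂ (o , _)) (inj₂ (_ , r)) = inj₂ (o , r)

  star⇒via : ∀ xs → (∀ x → x ∈ₗ xs) → ∀ {u v} → Star R u v → Via xs u v
  star⇒via xs full ε       = via-base xs (inj₁ refl)
  star⇒via xs full (r ◅ p) = via-trans xs (full _) (via-base xs (inj₂ r)) (star⇒via xs full p)

connected? : ∀ {V} (G : Graph V) → DecidableEquality V →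
             (xs : List V) → (∀ x → x ∈ₗ xs) → Dec (Connected G)
connected? G _≟V_ []         full = no λ c → contradiction (full (proj₁ c)) λ ()
connected? G _≟V_ xs@(x ∷ _) full =
  map′ (λ a → x , λ u v → All.lookup (All.lookup a (full u)) (full v))
       (λ c → All.universal (λ u → All.universal (proj₂ c u) xs) xs)
       (All.all? (λ u → All.all? (star? u) xs) xs)
  where
  star? : Decidable (Star (Adj G))
  star? u v = map′ (via⇒star (Adj G) xs) (star⇒via (Adj G) xs full)
                   (via? (Adj G) _≟V_ (adj? G) xs u v)

∃∈-≡ : ∀ {n} {S : Subset n} {u v : ∃ λ w → w ∈ S} → proj₁ u ≡ proj₁ v → u ≡ v
∃∈-≡ {u = u , p} {v = .u , q} refl = cong (u ,_) ([]=-irrelevant p q)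

∃∈-≟ : ∀ {n} {S : Subset n} → DecidableEquality (∃ λ v → v ∈ S)
∃∈-≟ u v = map′ ∃∈-≡ (cong proj₁) (proj₁ u ≟ proj₁ v)

weaken : ∀ {n b} {S : Subset n} → (∃ λ v → v ∈ S) → ∃ λ v → v ∈ (b ∷ S)
weaken (v , p) = suc v , there p

elements : ∀ {n} (S : Subset n) → List (∃ λ v → v ∈ S)
elements []            = []
elements (inside  ∷ S) = (zero , here) ∷ map weaken (elements S)
elements (outside ∷ S) = map weaken (elements S)

elements-full : ∀ {n} (S : Subset n) v → v ∈ₗ elements S
elements-full (inside  ∷ S) (zero  , here)    = here refl
elements-full (inside  ∷ S) (suc v , there p) = there (∈-map⁺ weaken (elements-full S (v , p)))
elements-full (outside ∷ S) (suc v , there p) = ∈-map⁺ weaken (elements-full S (v , p))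

connectedDominating? : ∀ {n} (G : Graph (Fin n)) S → Dec (ConnectedDominating G S)
connectedDominating? G S =
  all? (λ v → ¬? (v ∈? S) →-dec any? (λ u → (u ∈? S) ×-dec adj? G v u))
  ×-dec connected? (induced G S) ∃∈-≟ (elements S) (elements-full S)

⊤-connectedDominating : ∀ {n} (G : Graph (Fin n)) → Connected G → ConnectedDominating G ⊤
⊤-connectedDominating G (r , c) =
  (λ v v∉⊤ → contradiction ∈⊤ v∉⊤) ,
  (r , ∈⊤) ,
  λ u v → subst (λ w → Star _ w v) (∃∈-≡ refl)
            (subst (Star _ _) (∃∈-≡ refl)
              (gmap (λ w → w , ∈⊤) (λ a → a) (c (proj₁ u) (proj₁ v))))

least : ∀ {P : ℕ → Set} → (∀ c → Dec (P c)) → ∀ c → P c →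
        ∃ λ m → P m × (∀ l → P l → m ≤ l)
least {P} P? = <-rec (λ c → P c → ∃ λ m → P m × (∀ l → P l → m ≤ l)) step
  where
  step : ∀ c → (∀ {b} → b < c → P b → ∃ λ m → P m × (∀ l → P l → m ≤ l)) →
         P c → ∃ λ m → P m × (∀ l → P l → m ≤ l)
  step c rec pc with anyUpTo? P? c
  ... | yes (b , b<c , pb) = rec b<c pb
  ... | no  none           = c , pc , λ l pl → ≮⇒≥ (λ l<c → none (l , l<c , pl))

connectedDominationNumber : ∀ {n} (G : Graph (Fin n)) → Connected G →
                            ∃ (IsConnectedDominationNumber G)
connectedDominationNumber G conn
  with least (λ c → anySubset? (λ S → connectedDominating? G S ×-dec (∣ S ∣ ≟ℕ c)))
             _ (⊤ , ⊤-connectedDominating G conn , refl)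
... | m , attained , minimal = m , attained , λ S cds → minimal ∣ S ∣ (S , cds , refl)

γc : ∀ {n} (G : Graph (Fin n)) → Connected G → ℕ
γc G conn = proj₁ (connectedDominationNumber G conn)

γc-spec : ∀ {n} (G : Graph (Fin n)) (conn : Connected G) →
          IsConnectedDominationNumber G (γc G conn)
γc-spec G conn = proj₂ (connectedDominationNumber G conn)

{-# OPTIONS --safe #-}

-- Upper bound: let D be a minimum connected dominating set of F and d ∈ D.  The preimage S of D
-- dominates G, and lifting walks of D shows that every vertex of S is joined inside S to one of
-- the k vertices over d.  A walk of G between two of these representatives contains adjacent (or
-- equal) vertices v, w, where v is dominated by the part of S joined to the first one and w by the
-- part joined to the others; adding v and w to S makes one representative superfluous.  After
-- k − 1 such steps the set is connected, and it has at most k ∣D∣ + 2 (k − 1) vertices.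
--
-- Tightness: the cycle of length 3k is a k-fold cover of the triangle, and a connected dominating
-- set of a cycle misses at most two vertices.  Indeed, if it missed a < b < c, then the neighbour
-- dominating b would force it to lie in one of the open intervals (a , b), (b , c), and then it
-- would not dominate c or a, respectively.
module Submission where

open import Defs
open import Data.Empty using (⊥-elim)
open import Data.Fin.Base using (Fin; zero; suc; toℕ; fromℕ; inject₁) renaming (_<_ to _<ᶠ_)
open import Data.Fin.Induction using (<-weakInduction)
open import Data.Fin.Properties using (_≟_; all?; toℕ-fromℕ; toℕ-injective; toℕ-inject₁; toℕ<n)
open import Data.Fin.Relation.Unary.Top using (view; ‵fromℕ; ‵inject₁)
open import Data.Fin.Subset using (Subset; inside; outside; _∈_; _∉_; _⊆_; ⊥; ⁅_⁆; ∁; _∪_; ∣_∣)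
open import Data.Fin.Subset.Properties using (∉⊥; ∣⊥∣≡0; ∣⁅x⁆∣≡1; x∈⁅x⁆; x∈⁅y⁆⇒x≡y; x∈p∪q⁻; p⊆p∪q; q⊆p∪q; ∣∁p∣≡n∸∣p∣; x∈∁p⇒x∉p; _∈?_)
open import Data.List.Base using (List; []; _∷_; map; length; foldr)
open import Data.List.Membership.Propositional using () renaming (_∈_ to _∈ₗ_)
open import Data.List.Membership.Propositional.Properties using (∈-map⁺; ∈-map⁻)
open import Data.List.Properties using (length-map)
open import Data.List.Relation.Unary.Any using (here; there)
open import Data.Nat.Base using (ℕ; zero; suc; _+_; _*_; _∸_; _≤_; _<_; z≤n; s≤s; s≤s⁻¹)
open import Data.Nat.Properties using (≤-trans; ≤-reflexive; ≤-antisym; ≤∧≢⇒<; <-irrefl; <-trans; <⇒≱; <⇒≯; ≮⇒≥; +-assoc; +-comm; +-monoˡ-≤; +-monoʳ-≤; +-mono-≤; *-monoʳ-≤; *-comm; *-distribˡ-+; ∸-monoˡ-≤; m+n≤o⇒m≤o∸n; suc-injective; n<1+n; n≤1+n; 1+n≢n; +-suc; module ≤-Reasoning) renaming (_≟_ to _≟ℕ_; _<?_ to _<ℕ?_)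
open import Data.Product.Base using (Σ-syntax; ∃; _×_; _,_; proj₁; proj₂)
open import Data.Sum.Base using (_⊎_; inj₁; inj₂; swap)
open import Data.Vec.Base using ([]; _∷_; here; there)
open import Data.Vec.Properties using (lookup∘tabulate; lookup⇒[]=; []=⇒lookup)
open import Data.Vec.Properties.WithK using ([]=-irrelevant)
open import Function.Base using (_∘_)
open import Relation.Binary.Construct.Closure.ReflexiveTransitive using (Star; ε; _◅_; _◅◅_; gmap; reverse) renaming (map to map⋆)
open import Relation.Binary.PropositionalEquality using (_≡_; _≢_; refl; sym; trans; cong; subst)
open import Relation.Nullary.Decidable using (Dec; yes; no; does; dec-true; from-yes; ¬?; _⊎-dec_; _×-dec_)
open import Relation.Nullary.Negation using (¬_; contradiction)

-- Sizes and enumerations of subsets.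

∣p∪q∣≤∣p∣+∣q∣ : ∀ {n} (p q : Subset n) → ∣ p ∪ q ∣ ≤ ∣ p ∣ + ∣ q ∣
∣p∪q∣≤∣p∣+∣q∣ []            []            = z≤n
∣p∪q∣≤∣p∣+∣q∣ (inside  ∷ p) (inside  ∷ q) =
  s≤s (≤-trans (∣p∪q∣≤∣p∣+∣q∣ p q) (+-monoʳ-≤ ∣ p ∣ (n≤1+n ∣ q ∣)))
∣p∪q∣≤∣p∣+∣q∣ (inside  ∷ p) (outside ∷ q) = s≤s (∣p∪q∣≤∣p∣+∣q∣ p q)
∣p∪q∣≤∣p∣+∣q∣ (outside ∷ p) (inside  ∷ q) =
  ≤-trans (s≤s (∣p∪q∣≤∣p∣+∣q∣ p q)) (≤-reflexive (sym (+-suc ∣ p ∣ ∣ q ∣)))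
∣p∪q∣≤∣p∣+∣q∣ (outside ∷ p) (outside ∷ q) = ∣p∪q∣≤∣p∣+∣q∣ p q

members : ∀ {n} → Subset n → List (Fin n)
members S = map proj₁ (elements S)

∈-members⁺ : ∀ {n} {S : Subset n} {v} → v ∈ S → v ∈ₗ members S
∈-members⁺ {S = S} v∈S = ∈-map⁺ proj₁ (elements-full S (_ , v∈S))

∈-members⁻ : ∀ {n} {S : Subset n} {v} → v ∈ₗ members S → v ∈ S
∈-members⁻ v∈ with ∈-map⁻ proj₁ v∈
... | (_ , v∈S) , _ , refl = v∈S

length-elements : ∀ {n} (S : Subset n) → length (elements S) ≡ ∣ S ∣
length-elements []            = refl
length-elements (inside  ∷ S) = cong suc (trans (length-map weaken (elements S)) (length-elements S))
length-elements (outside ∷ S) = trans (length-map weaken (elements S)) (length-elements S)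

length-members : ∀ {n} (S : Subset n) → length (members S) ≡ ∣ S ∣
length-members S = trans (length-map proj₁ (elements S)) (length-elements S)

-- Fibres and preimages.

module _ {m n} (π : Fin n → Fin m) where

  ∈-fibre⁺ : ∀ {v u} → π v ≡ u → v ∈ fibre π u
  ∈-fibre⁺ {v} {u} e =
    lookup⇒[]= v _ (trans (lookup∘tabulate _ v) (dec-true (π v ≟ u) e))

  ∈-fibre⁻ : ∀ {v u} → v ∈ fibre π u → π v ≡ u
  ∈-fibre⁻ {v} {u} v∈ with π v ≟ u | trans (sym (lookup∘tabulate (λ w → does (π w ≟ u)) v)) ([]=⇒lookup v∈)
  ... | yes e | _ = e
  ... | no  _ | ()

  preimage : List (Fin m) → Subset n
  preimage = foldr (λ u S → fibre π u ∪ S) ⊥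

  ∈-preimage⁺ : ∀ {v us} → π v ∈ₗ us → v ∈ preimage us
  ∈-preimage⁺ (here e)  = p⊆p∪q _ (∈-fibre⁺ e)
  ∈-preimage⁺ (there i) = q⊆p∪q _ _ (∈-preimage⁺ i)

  ∈-preimage⁻ : ∀ {v} us → v ∈ preimage us → π v ∈ₗ us
  ∈-preimage⁻ []       v∈ = contradiction v∈ ∉⊥
  ∈-preimage⁻ (u ∷ us) v∈ with x∈p∪q⁻ (fibre π u) (preimage us) v∈
  ... | inj₁ i = here (∈-fibre⁻ i)
  ... | inj₂ i = there (∈-preimage⁻ us i)

  ∣preimage∣≤ : ∀ {k} → (∀ u → ∣ fibre π u ∣ ≡ k) → ∀ us → ∣ preimage us ∣ ≤ length us * k
  ∣preimage∣≤ size []       = ≤-reflexive (∣⊥∣≡0 n)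
  ∣preimage∣≤ size (u ∷ us) =
    ≤-trans (∣p∪q∣≤∣p∣+∣q∣ (fibre π u) (preimage us))
            (+-mono-≤ (≤-reflexive (size u)) (∣preimage∣≤ size us))

-- Joining the pieces of a dominating set.

module Inside {n} (G : Graph (Fin n)) where

  -- Membership sits on the steps rather than in the vertex type, so a walk survives enlarging `S`
  -- without changing its end points, unlike a walk in `induced G S`.
  Step : Subset n → Fin n → Fin n → Set
  Step S u v = u ∈ S × v ∈ S × Adj G u v

  Walk : Subset n → Fin n → Fin n → Set
  Walk S = Star (Step S)

  walk-sym : ∀ {S u v} → Walk S u v → Walk S v u
  walk-sym = reverse (λ { (p , q , a) → q , p , adj-sym G a })

  walk-mono : ∀ {S T u v} → S ⊆ T → Walk S u v → Walk T u v
  walk-mono S⊆T = map⋆ (λ { (p , q , a) → S⊆T p , S⊆T q , a })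

  fromInduced : ∀ {S u v} → Star (Adj (induced G S)) u v → Walk S (proj₁ u) (proj₁ v)
  fromInduced = gmap proj₁ (λ {u} {v} a → proj₂ u , proj₂ v , a)

  toInduced : ∀ {S u v} → Walk S u v → (p : u ∈ S) (q : v ∈ S) →
              Star (Adj (induced G S)) (u , p) (v , q)
  toInduced ε p q = subst (λ q → Star _ _ (_ , q)) ([]=-irrelevant p q) ε
  toInduced ((_ , w∈S , a) ◅ r) p q = a ◅ toInduced r w∈S q

  Adj⁼ : Fin n → Fin n → Set
  Adj⁼ u v = u ≡ v ⊎ Adj G u v

  hop : ∀ {S u v} → u ∈ S → v ∈ S → Adj⁼ u v → Walk S u v
  hop p q (inj₁ refl) = ε
  hop p q (inj₂ a)    = (p , q , a) ◅ ε

  Reaches : Subset n → List (Fin n) → Fin n → Set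
  Reaches S R v = ∃ λ r → r ∈ₗ R × Walk S v r

  -- This is the closed neighbourhood of the part of `S` joined to `R`; `Adj⁼` lets vertices of `S`
  -- and vertices dominated by `S` be treated alike.
  Near : Subset n → List (Fin n) → Fin n → Set
  Near S R v = ∃ λ s → s ∈ S × Adj⁼ v s × Reaches S R s

  near : ∀ {S R} → Dominating G S → (∀ {v} → v ∈ S → Reaches S R v) → ∀ v → Near S R v
  near {S} dom reach v with v ∈? S
  ... | yes v∈S = v , v∈S , inj₁ refl , reach v∈S
  ... | no  v∉S with dom v v∉S
  ...   | s , s∈S , a = s , s∈S , inj₂ a , reach s∈S

  split-near : ∀ {S x R v} → Near S (x ∷ R) v → Near S (x ∷ []) v ⊎ Near S R v
  split-near (s , s∈S , e , r , here p  , w) = inj₁ (s , s∈S , e , r , here p , w)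
  split-near (s , s∈S , e , r , there i , w) = inj₂ (s , s∈S , e , r , i , w)

  -- The first step at which `cov` answers `Q` gives the pair. If there is none, the last vertex
  -- satisfies both predicates, which is why the two vertices may be equal.
  crossing : ∀ {P Q : Fin n → Set} → (∀ v → P v ⊎ Q v) → ∀ {u w} → Star (Adj G) u w →
             P u → Q w → ∃ λ v → ∃ λ w → Adj⁼ v w × P v × Q w
  crossing cov ε p q = _ , _ , inj₁ refl , p , q
  crossing cov (_◅_ {j = v} a r) p q with cov v
  ... | inj₁ p′ = crossing cov r p′ q
  ... | inj₂ q′ = _ , _ , inj₂ a , p , q′

  -- Induction on the list of representatives: each round adds at most two vertices and discards the
  -- head `x`. Representatives may already be joined inside `S`; the round is made anyway, since
  -- only an upper bound on the size is claimed.
  connect : (∀ u v → Star (Adj G) u v) → ∀ x R S → Dominating G S →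
            (∀ {r} → r ∈ₗ x ∷ R → r ∈ S) → (∀ {v} → v ∈ S → Reaches S (x ∷ R) v) →
            ∃ λ T → ConnectedDominating G T × ∣ T ∣ ≤ ∣ S ∣ + length R * 2
  connect conn x [] S dom R⊆S reach =
    S , (dom , (x , x∈S) , λ { (u , p) (v , q) → toInduced (to p ◅◅ walk-sym (to q)) p q }) ,
    ≤-reflexive (+-comm 0 ∣ S ∣)
    where
    x∈S = R⊆S (here refl)
    to : ∀ {v} → v ∈ S → Walk S v x
    to p with reach p
    ... | _ , here refl , w = w
  connect conn x (y ∷ R) S dom R⊆S reach
    -- Domination places every vertex near `x` or near the other representatives, so a walk from `x`
    -- to `y` passes from one kind to the other.
    with crossing (split-near ∘ near dom reach) (conn x y)
           (x , R⊆S (here refl) , inj₁ refl , x , here refl , ε)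
           (y , R⊆S (there (here refl)) , inj₁ refl , y , here refl , ε)
  ... | v , w , v~w , (s , s∈S , v~s , _ , here refl , s⇝x) , (t , t∈S , w~t , r , r∈R , t⇝r)
    with connect conn y R T
           (λ u u∉T → let z , z∈S , a = dom u (u∉T ∘ S⊆T) in z , S⊆T z∈S , a)
           (S⊆T ∘ R⊆S ∘ there) reach′
    where
    T = S ∪ (⁅ v ⁆ ∪ ⁅ w ⁆)
    S⊆T : S ⊆ T
    S⊆T = p⊆p∪q _
    v∈T : v ∈ T
    v∈T = q⊆p∪q S _ (p⊆p∪q _ (x∈⁅x⁆ v))
    w∈T : w ∈ T
    w∈T = q⊆p∪q S _ (q⊆p∪q ⁅ v ⁆ _ (x∈⁅x⁆ w))
    w⇝r : Walk T w r
    w⇝r = hop w∈T (S⊆T t∈S) w~t ◅◅ walk-mono S⊆T t⇝r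
    v⇝r : Walk T v r
    v⇝r = hop v∈T w∈T v~w ◅◅ w⇝r
    x⇝r : Walk T x r
    x⇝r = walk-sym (hop v∈T (S⊆T s∈S) v~s ◅◅ walk-mono S⊆T s⇝x) ◅◅ v⇝r
    reach′ : ∀ {z} → z ∈ T → Reaches T (y ∷ R) z
    reach′ z∈T with x∈p∪q⁻ S _ z∈T
    ... | inj₁ z∈S with reach z∈S
    -- What was joined only to `x` is redirected to `r` through `s`, `v`, `w` and `t`.
    ...   | _ , here refl , z⇝x = r , r∈R , walk-mono S⊆T z⇝x ◅◅ x⇝r
    ...   | q , there i   , z⇝q = q , i , walk-mono S⊆T z⇝q
    reach′ z∈T | inj₂ z∈vw with x∈p∪q⁻ ⁅ v ⁆ ⁅ w ⁆ z∈vw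
    ...   | inj₁ z∈v = r , r∈R , subst (λ z → Walk T z r) (sym (x∈⁅y⁆⇒x≡y v z∈v)) v⇝r
    ...   | inj₂ z∈w = r , r∈R , subst (λ z → Walk T z r) (sym (x∈⁅y⁆⇒x≡y w z∈w)) w⇝r
  ... | U , cds , ∣U∣≤ = U , cds , (begin
    ∣ U ∣                                             ≤⟨ ∣U∣≤ ⟩
    ∣ S ∪ (⁅ v ⁆ ∪ ⁅ w ⁆) ∣ + length R * 2            ≤⟨ +-monoˡ-≤ (length R * 2) grow ⟩
    ∣ S ∣ + 2 + length R * 2                          ≡⟨ +-assoc ∣ S ∣ 2 (length R * 2) ⟩
    ∣ S ∣ + (2 + length R * 2)                        ∎)
    where
    open ≤-Reasoning
    grow : ∣ S ∪ (⁅ v ⁆ ∪ ⁅ w ⁆) ∣ ≤ ∣ S ∣ + 2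
    grow = begin
      ∣ S ∪ (⁅ v ⁆ ∪ ⁅ w ⁆) ∣       ≤⟨ ∣p∪q∣≤∣p∣+∣q∣ S _ ⟩
      ∣ S ∣ + ∣ ⁅ v ⁆ ∪ ⁅ w ⁆ ∣     ≤⟨ +-monoʳ-≤ ∣ S ∣ (∣p∪q∣≤∣p∣+∣q∣ ⁅ v ⁆ ⁅ w ⁆) ⟩
      ∣ S ∣ + (∣ ⁅ v ⁆ ∣ + ∣ ⁅ w ⁆ ∣) ≤⟨ +-monoʳ-≤ ∣ S ∣ (+-mono-≤ (≤-reflexive (∣⁅x⁆∣≡1 v)) (≤-reflexive (∣⁅x⁆∣≡1 w))) ⟩
      ∣ S ∣ + 2                     ∎

-- The upper bound for covers.

module _ {k m n} {F : Graph (Fin m)} {G : Graph (Fin n)} (cover : KFoldCover k G F) where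
  open KFoldCover cover
  open Inside

  -- Local surjectivity lifts one edge at a time from the vertex reached so far. The start of the
  -- lift is prescribed, but of its end only the fibre is known; hence all vertices over `d` serve
  -- as representatives below.
  lift-walk : ∀ {D S} → (∀ {v} → π v ∈ D → v ∈ S) → ∀ {v x y} → π v ≡ x →
              Walk F D x y → ∃ λ w → π w ≡ y × Walk G S v w
  lift-walk lift {v} e    ε = v , e , ε
  lift-walk lift {v} refl ((p , q , a) ◅ r) with nbr-surjective v a
  ... | w , vw , refl with lift-walk lift refl r
  ...   | z , e , w⇝z = z , e , (lift p , lift q , vw) ◅ w⇝z

  lift-connectedDominating : Connected G → ∀ D → ConnectedDominating F D →
                             ∃ λ T → ConnectedDominating G T × ∣ T ∣ ≤ k * (∣ D ∣ + 2) ∸ 2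
  lift-connectedDominating (_ , connG) D (dom , (d , d∈D) , connD)
    with members (fibre π d) in eq | length-members (fibre π d)
  -- Surjectivity of `π` gives a vertex over `d`, so there is a first representative.
  ... | [] | _ = ⊥-elim (none (subst (_ ∈ₗ_) eq (∈-members⁺ (∈-fibre⁺ π (proj₂ (onto d) refl)))))
    where
    none : ∀ {v : Fin n} → ¬ (v ∈ₗ [])
    none ()
  ... | x ∷ R | len with connect G connG x R S dom′ R⊆S reach
    where
    S = preimage π (members D)
    lift : ∀ {v} → π v ∈ D → v ∈ S
    lift = ∈-preimage⁺ π ∘ ∈-members⁺
    dom′ : Dominating G S
    dom′ v v∉S with dom (π v) (v∉S ∘ lift)
    ... | u , u∈D , a with nbr-surjective v a
    ...   | w , vw , refl = w , lift u∈D , vw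
    R⊆S : ∀ {r} → r ∈ₗ x ∷ R → r ∈ S
    R⊆S r∈ = lift (subst (_∈ D) (sym (∈-fibre⁻ π (∈-members⁻ (subst (_ ∈ₗ_) (sym eq) r∈)))) d∈D)
    reach : ∀ {v} → v ∈ S → Reaches G S (x ∷ R) v
    reach v∈S
      with lift-walk lift refl (fromInduced F (connD (_ , ∈-members⁻ (∈-preimage⁻ π (members D) v∈S)) (d , d∈D)))
    ... | w , πw≡d , v⇝w = w , subst (w ∈ₗ_) eq (∈-members⁺ (∈-fibre⁺ π πw≡d)) , v⇝w
  ... | T , cds , ∣T∣≤ = T , cds , (begin
    ∣ T ∣                                   ≤⟨ ∣T∣≤ ⟩
    ∣ preimage π (members D) ∣ + length R * 2 ≤⟨ +-monoˡ-≤ (length R * 2) (∣preimage∣≤ π fibre-size (members D)) ⟩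
    length (members D) * k + length R * 2   ≡⟨ cong (λ l → l * k + length R * 2) (length-members D) ⟩
    ∣ D ∣ * k + length R * 2                ≡⟨ arith ⟩
    k * (∣ D ∣ + 2) ∸ 2                     ∎)
    where
    open ≤-Reasoning
    k≡ : suc (length R) ≡ k
    k≡ = trans len (fibre-size d)
    -- Since `k` is `suc (length R)`, the summand `k * 2` contains the 2 to be removed, and the
    -- truncated subtraction is exact.
    arith : ∣ D ∣ * k + length R * 2 ≡ k * (∣ D ∣ + 2) ∸ 2
    arith = sym (begin-equality
      k * (∣ D ∣ + 2) ∸ 2                         ≡⟨ cong (_∸ 2) (*-distribˡ-+ k ∣ D ∣ 2) ⟩
      k * ∣ D ∣ + k * 2 ∸ 2                       ≡⟨ cong (λ l → k * ∣ D ∣ + l * 2 ∸ 2) k≡ ⟨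
      k * ∣ D ∣ + (2 + length R * 2) ∸ 2          ≡⟨ cong (_∸ 2) (+-assoc (k * ∣ D ∣) 2 _) ⟨
      k * ∣ D ∣ + 2 + length R * 2 ∸ 2            ≡⟨ cong (λ l → l + length R * 2 ∸ 2) (+-comm (k * ∣ D ∣) 2) ⟩
      k * ∣ D ∣ + length R * 2                    ≡⟨ cong (_+ length R * 2) (*-comm k ∣ D ∣) ⟩
      ∣ D ∣ * k + length R * 2                    ∎)

  cover-bound : ∀ {c d} → IsConnectedDominationNumber F c → Connected G →
                IsConnectedDominationNumber G d → d ≤ k * (c + 2) ∸ 2
  cover-bound ((D , cds , refl) , _) cG (_ , minimal) =
    let T , cdsT , ∣T∣≤ = lift-connectedDominating cG D cds
    in ≤-trans (minimal T cdsT) ∣T∣≤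

-- Cycles and their cyclic successor relation.

Next : ∀ {n} → Fin n → Fin n → Set
Next {n} u v = suc (toℕ u) ≡ toℕ v ⊎ (toℕ v ≡ 0 × suc (toℕ u) ≡ n)

next? : ∀ {n} (u v : Fin n) → Dec (Next u v)
next? {n} u v = (suc (toℕ u) ≟ℕ toℕ v) ⊎-dec ((toℕ v ≟ℕ 0) ×-dec (suc (toℕ u) ≟ℕ n))

-- The cycle of length n + 2; for n = 0 it is a single edge.
cycle : ∀ n → Graph (Fin (2 + n))
cycle n = record
  { Adj     = λ u v → Next u v ⊎ Next v u
  ; adj?    = λ u v → next? u v ⊎-dec next? v u
  ; adj-sym = swap
  ; irrefl  = λ { (inj₁ e) → next-irrefl e ; (inj₂ e) → next-irrefl e }
  }
  where
  next-irrefl : ∀ {v : Fin (2 + n)} → ¬ Next v v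
  next-irrefl (inj₁ e)             = 1+n≢n e
  next-irrefl {zero}  (inj₂ (_ , ()))
  next-irrefl {suc v} (inj₂ (() , _))

cycle-connected : ∀ n → Connected (cycle n)
cycle-connected n = zero , λ u v → reverse swap (from0 u) ◅◅ from0 v
  where
  from0 : ∀ v → Star (Adj (cycle n)) zero v
  from0 = <-weakInduction (Star _ zero) ε
    (λ i w → w ◅◅ (inj₁ (inj₁ (cong suc (toℕ-inject₁ i))) ◅ ε))

-- With `next-injective`, this determines an edge at a vertex by its direction, the basis for
-- checking the cover locally. In the mixed cases a vertex would have to carry the number `n`.
next-functional : ∀ {n} {u v w : Fin n} → Next u v → Next u w → v ≡ w
next-functional (inj₁ p) (inj₁ q) = toℕ-injective (trans (sym p) q)
next-functional {v = v} (inj₁ p) (inj₂ (_ , q)) = contradiction (toℕ<n v) (<-irrefl (trans (sym p) q))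
next-functional {w = w} (inj₂ (_ , p)) (inj₁ q) = contradiction (toℕ<n w) (<-irrefl (trans (sym q) p))
next-functional (inj₂ (p , _)) (inj₂ (q , _)) = toℕ-injective (trans p (sym q))

next-injective : ∀ {n} {u v w : Fin n} → Next v u → Next w u → v ≡ w
next-injective (inj₁ p) (inj₁ q) = toℕ-injective (suc-injective (trans p (sym q)))
next-injective (inj₁ p) (inj₂ (q , _)) = contradiction (trans p q) λ ()
next-injective (inj₂ (p , _)) (inj₁ q) = contradiction (trans q p) λ ()
next-injective (inj₂ (_ , p)) (inj₂ (_ , q)) = toℕ-injective (suc-injective (trans p (sym q)))

-- Increasing triples in a subset.

private
  variable
    n : ℕ

∃-increasing₁ : (p : Subset n) → 1 ≤ ∣ p ∣ → ∃ (_∈ p)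
∃-increasing₁ (inside  ∷ p) _ = zero , here
∃-increasing₁ (outside ∷ p) l with ∃-increasing₁ p l
... | a , a∈p = suc a , there a∈p

∃-increasing₂ : (p : Subset n) → 2 ≤ ∣ p ∣ → ∃ λ a → ∃ λ b → a <ᶠ b × a ∈ p × b ∈ p
∃-increasing₂ (inside  ∷ p) (s≤s l) with ∃-increasing₁ p l
... | b , b∈p = zero , suc b , s≤s z≤n , here , there b∈p
∃-increasing₂ (outside ∷ p) l with ∃-increasing₂ p l
... | a , b , a<b , a∈p , b∈p = suc a , suc b , s≤s a<b , there a∈p , there b∈p

∃-increasing₃ : (p : Subset n) → 3 ≤ ∣ p ∣ →
                ∃ λ a → ∃ λ b → ∃ λ c → a <ᶠ b × b <ᶠ c × a ∈ p × b ∈ p × c ∈ p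
∃-increasing₃ (inside  ∷ p) (s≤s l) with ∃-increasing₂ p l
... | b , c , b<c , b∈p , c∈p =
  zero , suc b , suc c , s≤s z≤n , s≤s b<c , here , there b∈p , there c∈p
∃-increasing₃ (outside ∷ p) l with ∃-increasing₃ p l
... | a , b , c , a<b , b<c , a∈p , b∈p , c∈p =
  suc a , suc b , suc c , s≤s a<b , s≤s b<c , there a∈p , there b∈p , there c∈p

-- Connected dominating sets of a cycle.

Between : Fin n → Fin n → Fin n → Set
Between a b v = a <ᶠ v × v <ᶠ b

-- An edge through the end of the numbering has no end strictly between two vertices.
between-step : ∀ {n} {a b v w : Fin (2 + n)} → Between a b v → Adj (cycle n) v w →
               w ≢ a → w ≢ b → Between a b w
between-step (a<v , v<b) (inj₁ (inj₁ e)) w≢a w≢b =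
  subst (_ <_) e (<-trans a<v (n<1+n _)) , ≤∧≢⇒< (subst (_≤ _) e v<b) (w≢b ∘ toℕ-injective)
between-step {b = b} (_ , v<b) (inj₁ (inj₂ (_ , e))) _ _ =
  contradiction (toℕ<n b) (λ b<n → <⇒≱ b<n (subst (_≤ toℕ b) e v<b))
between-step (a<v , v<b) (inj₂ (inj₁ e)) w≢a w≢b =
  ≤∧≢⇒< (s≤s⁻¹ (subst (_ <_) (sym e) a<v)) (w≢a ∘ sym ∘ toℕ-injective) ,
  <-trans (subst (_ <_) e (n<1+n _)) v<b
between-step (a<v , _) (inj₂ (inj₂ (e , _))) _ _ = contradiction (subst (_ <_) e a<v) λ ()

module _ {n} {S : Subset (2 + n)} (cds : ConnectedDominating (cycle n) S) where
  open Inside (cycle n)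

  between-walk : ∀ {a b v w} → a ∉ S → b ∉ S → Walk S v w → Between a b v → Between a b w
  between-walk a∉S b∉S ε bt = bt
  between-walk a∉S b∉S ((_ , w∈S , e) ◅ r) bt =
    between-walk a∉S b∉S r
      (between-step bt e (λ { refl → a∉S w∈S }) (λ { refl → b∉S w∈S }))

  -- A walk inside `S` cannot pass the missed vertices `a` and `b`, so connectedness confines `S` to
  -- the interval as soon as one of its vertices is there.
  between-all : ∀ {a b v w} → a ∉ S → b ∉ S → v ∈ S → Between a b v → w ∈ S → Between a b w
  between-all a∉S b∉S v∈S bt w∈S =
    between-walk a∉S b∉S (fromInduced (proj₂ (proj₂ cds) (_ , v∈S) (_ , w∈S))) bt

  no-three-missed : ∀ {a b c} → a <ᶠ b → b <ᶠ c → a ∉ S → b ∉ S → ¬ (c ∉ S)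
  no-three-missed {a} {b} {c} a<b b<c a∉S b∉S c∉S with proj₁ cds b b∉S
  ... | s , s∈S , bs
    with between-step (a<b , b<c) bs (λ { refl → a∉S s∈S }) (λ { refl → c∉S s∈S })
  ...   | a<s , s<c with toℕ s <ℕ? toℕ b
  ...     | yes s<b with proj₁ cds c c∉S
  ...       | t , t∈S , ct =
    -- Here `t` lies in the interval from `a` to `b`. Stepping from `t` to its neighbour `c` would
    -- put `c` there too.
    <⇒≯ b<c (proj₂ (between-step (between-all a∉S b∉S s∈S (a<s , s<b) t∈S) (swap ct)
                     (λ { refl → <⇒≯ a<b b<c }) (λ { refl → <-irrefl refl b<c })))
  no-three-missed {a} {b} {c} a<b b<c a∉S b∉S c∉S | s , s∈S , bs | a<s , s<c | no s≮b
    with proj₁ cds a a∉S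
  ...       | t , t∈S , at =
    -- The mirror case: `t` lies between `b` and `c`, and its neighbour `a` would follow.
    <⇒≯ a<b (proj₁ (between-step (between-all b∉S c∉S s∈S (b<s , s<c) t∈S) (swap at)
                     (λ { refl → <-irrefl refl a<b }) (λ { refl → <⇒≯ a<b b<c })))
    where
    b<s : b <ᶠ s
    b<s = ≤∧≢⇒< (≮⇒≥ s≮b) (λ e → b∉S (subst (_∈ S) (sym (toℕ-injective e)) s∈S))

  connectedDominating-cycle-≥ : n ≤ ∣ S ∣
  connectedDominating-cycle-≥ = ≮⇒≥ λ ∣S∣<n →
    let a , b , c , a<b , b<c , a∈ , b∈ , c∈ =
          -- The cycle has `2 + n` vertices, so fewer than `n` in `S` leave at least three outside.
          ∃-increasing₃ (∁ S) (subst (3 ≤_) (sym (∣∁p∣≡n∸∣p∣ S)) (m+n≤o⇒m≤o∸n 3 (s≤s (s≤s ∣S∣<n))))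
    in no-three-missed a<b b<c (x∈∁p⇒x∉p a∈) (x∈∁p⇒x∉p b∈) (x∈∁p⇒x∉p c∈)

-- The covering of the triangle by a cycle.

mod3 : ∀ k → Fin (k * 3) → Fin 3
mod3 (suc k) zero                = zero
mod3 (suc k) (suc zero)          = suc zero
mod3 (suc k) (suc (suc zero))    = suc (suc zero)
mod3 (suc k) (suc (suc (suc v))) = mod3 k v

mod3-last : ∀ k (v : Fin (k * 3)) → suc (toℕ v) ≡ k * 3 → mod3 k v ≡ suc (suc zero)
mod3-last (suc zero)    (suc (suc zero))    _ = refl
mod3-last (suc (suc k)) (suc (suc (suc v))) e =
  mod3-last (suc k) v (suc-injective (suc-injective (suc-injective e)))

-- The closing edge of the long cycle and the edges between consecutive blocks of three all run from
-- residue 2 to residue 0, onto the closing edge of the triangle.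
mod3-next : ∀ k {v w : Fin (k * 3)} → Next v w → Next (mod3 k v) (mod3 k w)
mod3-next (suc k) {v} {zero} (inj₂ (_ , e)) rewrite mod3-last (suc k) v e = inj₂ (refl , refl)
mod3-next (suc k) {zero}     {suc zero}       (inj₁ _) = inj₁ refl
mod3-next (suc k) {suc zero} {suc (suc zero)} (inj₁ _) = inj₁ refl
mod3-next (suc (suc k)) {suc (suc zero)} {suc (suc (suc zero))} (inj₁ _) = inj₂ (refl , refl)
mod3-next (suc k) {suc (suc (suc v))} {suc (suc (suc w))} (inj₁ e) =
  mod3-next k (inj₁ (suc-injective (suc-injective (suc-injective e))))

-- Because `mod3` recurses by blocks of three, the fibre unfolds by computation, and each block
-- contributes one vertex.
∣fibre-mod3∣ : ∀ k u → ∣ fibre (mod3 k) u ∣ ≡ k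
∣fibre-mod3∣ zero    u                = refl
∣fibre-mod3∣ (suc k) zero             = cong suc (∣fibre-mod3∣ k zero)
∣fibre-mod3∣ (suc k) (suc zero)       = cong suc (∣fibre-mod3∣ k (suc zero))
∣fibre-mod3∣ (suc k) (suc (suc zero)) = cong suc (∣fibre-mod3∣ k (suc (suc zero)))

∃-next : ∀ {n} (v : Fin (suc n)) → ∃ λ w → Next v w
∃-next v with view v
... | ‵fromℕ {n} = zero , inj₂ (refl , cong suc (toℕ-fromℕ n))
... | ‵inject₁ j  = suc j , inj₁ (cong suc (toℕ-inject₁ j))

∃-previous : ∀ {n} (v : Fin (suc n)) → ∃ λ w → Next w v
∃-previous {n} zero = fromℕ n , inj₂ (refl , cong suc (toℕ-fromℕ n))
∃-previous (suc v)  = inject₁ v , inj₁ (cong suc (toℕ-inject₁ v))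

-- This separates the images of the successor and the predecessor of a vertex, the one case of local
-- injectivity not settled by direction. The nine pairs are checked by computation.
next₃-asym : (u v : Fin 3) → ¬ (Next u v × Next v u)
next₃-asym = from-yes (all? {3} λ u → all? {3} λ v → ¬? (next? u v ×-dec next? v u))

triangle-cover : ∀ k → KFoldCover (suc k) (cycle (suc (k * 3))) (cycle 1)
triangle-cover k = record
  { π              = π
  ; onto           = λ
    { zero             → zero , λ { refl → refl }
    ; (suc zero)       → suc zero , λ { refl → refl }
    ; (suc (suc zero)) → suc (suc zero) , λ { refl → refl }
    }
  ; nbr-maps       = λ
    { _ (inj₁ e) → inj₁ (mod3-next (suc k) e)
    ; _ (inj₂ e) → inj₂ (mod3-next (suc k) e)
    }
  ; nbr-injective  = λ
    { _ (inj₁ e) (inj₁ f) _ → next-functional e f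
    ; _ (inj₂ e) (inj₂ f) _ → next-injective e f
    ; _ (inj₁ e) (inj₂ f) eq → opposite e f eq
    ; _ (inj₂ e) (inj₁ f) eq → sym (opposite f e (sym eq))
    }
  ; nbr-surjective = surj
  ; fibre-size     = ∣fibre-mod3∣ (suc k)
  }
  where
  π = mod3 (suc k)
  opposite : ∀ {v w w′} → Next v w → Next w′ v → π w ≡ π w′ → w ≡ w′
  opposite {v} {w} {w′} e f eq = contradiction
    (subst (Next (π v)) eq (mod3-next (suc k) e) , mod3-next (suc k) f)
    (next₃-asym (π v) (π w′))
  surj : ∀ v {x} → Adj (cycle 1) (π v) x → ∃ λ w → Adj (cycle (suc (k * 3))) v w × π w ≡ x
  surj v (inj₁ e) with ∃-next v
  -- The successor of `v` lies over a successor of `π v`, and `x` is the only one.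
  ... | w , f = w , inj₁ f , next-functional (mod3-next (suc k) f) e
  surj v (inj₂ e) with ∃-previous v
  ... | w , f = w , inj₂ f , next-injective (mod3-next (suc k) f) e

-- Tightness of the bound.

triangle-≤ : ∀ {c} → IsConnectedDominationNumber (cycle 1) c → c ≤ 1
triangle-≤ (_ , minimal) = minimal ⁅ zero ⁆ (from-yes (connectedDominating? (cycle 1) ⁅ zero ⁆))

cycle-≥ : ∀ {n c} → IsConnectedDominationNumber (cycle n) c → n ≤ c
cycle-≥ ((S , cds , refl) , _) = connectedDominating-cycle-≥ cds

triangle-cover-tight : ∀ k {c d} → IsConnectedDominationNumber (cycle 1) c →
                       IsConnectedDominationNumber (cycle (suc (k * 3))) d →
                       d ≡ suc k * (c + 2) ∸ 2
triangle-cover-tight k isF isG =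
  ≤-antisym (cover-bound (triangle-cover k) isF (cycle-connected _) isG)
    -- For `c` at most 1 the bound is at most `suc k * 3 ∸ 2`, which computes to `suc (k * 3)`, the
    -- index of the cycle and hence a lower bound for `d`.
    (≤-trans (∸-monoˡ-≤ 2 (*-monoʳ-≤ (suc k) (+-monoˡ-≤ 2 (triangle-≤ isF)))) (cycle-≥ isG))

theorem2p15 : ((k m n : ℕ) (F : Graph (Fin m)) (G : Graph (Fin n))
    (cF : Connected F) (cG : Connected G) →
    KFoldCover k G F →
    γc G cG ≤ k * (γc F cF + 2) ∸ 2)
    ×
    ((k : ℕ) → 1 ≤ k →
    Σ[ m ∈ ℕ ] Σ[ n ∈ ℕ ] Σ[ F ∈ Graph (Fin m) ] Σ[ G ∈ Graph (Fin n) ]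
    Σ[ cF ∈ Connected F ] Σ[ cG ∈ Connected G ]
    (KFoldCover k G F × γc G cG ≡ k * (γc F cF + 2) ∸ 2))
theorem2p15 =
  (λ k m n F G cF cG cover → cover-bound cover (γc-spec F cF) cG (γc-spec G cG)) ,
  λ { (suc k) _ →
      -- The vertex count `suc k * 3` reduces to `2 + suc (k * 3)`, as the indexing of `cycle`
      -- requires.
      3 , suc k * 3 , cycle 1 , cycle (suc (k * 3)) ,
      cycle-connected 1 , cycle-connected (suc (k * 3)) , triangle-cover k ,
      triangle-cover-tight k (γc-spec (cycle 1) (cycle-connected 1))
        (γc-spec (cycle (suc (k * 3))) (cycle-connected (suc (k * 3)))) }
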